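{- Let $t,k\ge2$ be integers with $(t+1)\mid(k+1)$. Then $N(tk+i,k)=N(tk-i,k)=t-i$ for every integer $0\le i\le t$.
   Context: For $n>k\ge1$, $N(n,k)$ is the nullity of the $n\times n$ skew-symmetric Toeplitz matrix $A(n,k)$ whose first $k$ superdiagonals have all entries $1$ and whose remaining superdiagonals have all entries $0$. This nullity depends only on $n\bmod (k^2+k)$, and $N(n,k)$ is defined for every integer $n$ as $N(n',k)$ for any $n'>k$ with $n'\equiv n\pmod{k^2+k}$. -}

module Defs where

open import Algebra.Properties.CommutativeMonoid.Sum using (sum)
open import Data.Bool.Base using (if_then_else_)
open import Data.Fin.Base using (Fin; toℕ)
open import Data.Integer.Base as ℤ using (ℤ; +_; -[1+_]; _⊖_)
open import Data.Integer.Divisibility using (_∣_)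
open import Data.Nat.Base as ℕ using (ℕ; zero; suc; _≤ᵇ_)
open import Data.Product.Base using (Σ; ∃)
open import Data.Rational.Base using (ℚ; 0ℚ; 1ℚ; _*_; -_)
open import Data.Rational.Properties using (+-0-commutativeMonoid)
open import Data.Vec.Functional using (Vector)
open import Relation.Binary.PropositionalEquality.Core using (_≡_)

∑ : ∀ {n} → Vector ℚ n → ℚ
∑ = sum +-0-commutativeMonoid

Matrix : ℕ → ℕ → Set
Matrix m n = Fin m → Fin n → ℚ

InKernel : ∀ {m n} → Matrix m n → Vector ℚ n → Set
InKernel M v = ∀ i → ∑ (λ j → M i j * v j) ≡ 0ℚ

linComb : ∀ {d n} → Vector ℚ d → (Fin d → Vector ℚ n) → Vector ℚ n
linComb c b j = ∑ (λ l → c l * b l j)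

LinearlyIndependent : ∀ {d n} → (Fin d → Vector ℚ n) → Set
LinearlyIndependent b = ∀ c → (∀ j → linComb c b j ≡ 0ℚ) → ∀ l → c l ≡ 0ℚ

record IsKernelBasis {m n d} (M : Matrix m n) (b : Fin d → Vector ℚ n) : Set where
  field
    inKernel    : ∀ l → InKernel M (b l)
    independent : LinearlyIndependent b
    spanning    : ∀ v → InKernel M v → ∃ λ c → ∀ j → v j ≡ linComb c b j

-- The nullity of M, i.e. the dimension of its kernel, is d.
HasNullity : ∀ {m n} → Matrix m n → ℕ → Set
HasNullity {n = n} M d = Σ (Fin d → Vector ℚ n) (IsKernelBasis M)

-- The common entry of A(n,k) on the diagonal with (column − row) = s.
diagonalEntry : ℕ → ℤ → ℚ
diagonalEntry k (+ zero)    = 0ℚ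
diagonalEntry k (+ (suc s)) = if suc s ≤ᵇ k then 1ℚ else 0ℚ
diagonalEntry k -[1+ s ]    = - (if suc s ≤ᵇ k then 1ℚ else 0ℚ)

A : (n k : ℕ) → Matrix n n
A n k i j = diagonalEntry k (toℕ j ⊖ toℕ i)

-- N(n,k) = d for an arbitrary integer n.  N(n,k) is the nullity of A(n′,k)
-- for any n′ > k congruent to n modulo k² + k; all such n′ are required to
-- give the value d (such n′ exist whenever k ≥ 1).
infix 4 N[_,_]≡_

N[_,_]≡_ : ℤ → ℕ → ℕ → Set
N[ n , k ]≡ d =
  ∀ n′ → k ℕ.< n′ → + (k ℕ.* k ℕ.+ k) ∣ + n′ ℤ.- n → HasNullity (A n′ k) d

{-# OPTIONS --safe #-}
module Submission where

-- Extend v ∈ ker A(n,k) by zeros and let S be its sums over windows of length k.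
-- Row j of the system says S(j) = S(j + k + 1), and conversely v is recovered from S
-- by summing its differences along steps of length k.  So ker A(n,k) consists of the
-- sequences v_j = η(j mod k) − η(j + k), where η has period k + 1, η(k) = 0, and the
-- same formula gives zero for n ≤ j < n + k.  These last k equations permute the
-- residues modulo k + 1.  For n ≡ tk ± i the permutation is the rotation by t + 1, with
-- t + 1 cycles as (t + 1) ∣ (k + 1), composed with a cycle on i + 1 consecutive
-- residues, which merges i + 1 of these cycles into the one on which η vanishes.
-- The remaining t − i cycles are the free coordinates.

open import Defs
open import Algebra.Bundles using (module CommutativeRing)
open import Data.Bool.Base using (T; if_then_else_; true; false)
open import Data.Fin.Base using (Fin; toℕ; fromℕ<; zero; suc)
open import Data.Fin.Properties using (toℕ<n; toℕ-fromℕ<)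
open import Data.Integer.Base using (+_; _-_)
import Data.Integer.Base as ℤ
import Data.Integer.Divisibility as ℤ
import Data.Integer.Properties as ℤ
open import Data.Nat.Base using (ℕ; zero; suc; _+_; _*_; _∸_; _≤_; _<_; _≤ᵇ_; s≤s; z≤n; s≤s⁻¹; s<s⁻¹; NonZero; >-nonZero)
open import Data.Nat.Divisibility using (_∣_; divides; divides-refl; _∣0; ∣-refl; n∣m*n; m∣m*n; ∣n⇒∣m*n; ∣⇒≤)
open import Data.Nat.DivMod
open import Data.Nat.Properties
import Data.Nat.Solver as ℕ
open import Data.Product.Base using (_×_; _,_; ∃)
open import Data.Rational.Base as ℚ using (ℚ; 0ℚ; 1ℚ)
import Data.Rational.Properties as ℚ
import Data.Rational.Solver as ℚ
open import Data.Sum.Base using (_⊎_; inj₁; inj₂)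
open import Data.Vec.Functional using (Vector; tail)
open import Function.Base using (_∘_)
open import Relation.Binary.PropositionalEquality
open import Relation.Nullary.Decidable using (yes; no)
open import Relation.Nullary.Negation using (contradiction)

open import Algebra.Properties.CommutativeMonoid.Sum ℚ.+-0-commutativeMonoid using (sum-cong-≗; ∑-distrib-+)
open import Algebra.Properties.Group ℚ.+-0-group using (∙-cancelˡ; x∙y⁻¹≈ε⇒x≈y)
open import Algebra.Properties.Semiring.Sum (CommutativeRing.semiring ℚ.+-*-commutativeRing) using (*-distribˡ-sum)

open ≡-Reasoning

-- Sums over initial segments of the natural numbers.

∑< : ℕ → (ℕ → ℚ) → ℚ
∑< n f = ∑ {n} (f ∘ toℕ)

∑<-cong : ∀ n {f g : ℕ → ℚ} → (∀ x → x < n → f x ≡ g x) → ∑< n f ≡ ∑< n g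
∑<-cong n f≗g = sum-cong-≗ (λ x → f≗g (toℕ x) (toℕ<n x))

∑<-zero : ∀ n {f : ℕ → ℚ} → (∀ x → x < n → f x ≡ 0ℚ) → ∑< n f ≡ 0ℚ
∑<-zero zero    f≗0 = refl
∑<-zero (suc n) f≗0 =
  cong₂ ℚ._+_ (f≗0 0 (s≤s z≤n)) (∑<-zero n (λ x x<n → f≗0 (suc x) (s≤s x<n)))

∑<-+ : ∀ m n (f : ℕ → ℚ) → ∑< (m + n) f ≡ ∑< m f ℚ.+ ∑< n (λ x → f (m + x))
∑<-+ zero    n f = sym (ℚ.+-identityˡ _)
∑<-+ (suc m) n f =
  trans (cong (f 0 ℚ.+_) (∑<-+ m n (f ∘ suc))) (sym (ℚ.+-assoc (f 0) _ _))

∑<-last : ∀ n (f : ℕ → ℚ) → ∑< (suc n) f ≡ ∑< n f ℚ.+ f n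
∑<-last n f = begin
  ∑< (suc n) f                     ≡⟨ cong (λ m → ∑< m f) (+-comm 1 n) ⟩
  ∑< (n + 1) f                     ≡⟨ ∑<-+ n 1 f ⟩
  ∑< n f ℚ.+ (f (n + 0) ℚ.+ 0ℚ)    ≡⟨ cong (∑< n f ℚ.+_) (ℚ.+-identityʳ _) ⟩
  ∑< n f ℚ.+ f (n + 0)             ≡⟨ cong (λ m → ∑< n f ℚ.+ f m) (+-identityʳ n) ⟩
  ∑< n f ℚ.+ f n                   ∎

∑<-neg : ∀ n (f : ℕ → ℚ) → ∑< n (ℚ.-_ ∘ f) ≡ ℚ.- ∑< n f
∑<-neg zero    f = refl
∑<-neg (suc n) f =
  trans (cong (ℚ.- f 0 ℚ.+_) (∑<-neg n (f ∘ suc))) (sym (ℚ.neg-distrib-+ (f 0) _))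

-- Extension of a vector by zeros.

-- The `k` leading zeros keep all indices natural: coordinate `l` sits at position `k + l`, and a
-- window may start to the left of the vector.
pad : ∀ {n} → ℕ → Vector ℚ n → ℕ → ℚ
pad         (suc k) v zero    = 0ℚ
pad         (suc k) v (suc j) = pad k v j
pad {zero}  zero    v j       = 0ℚ
pad {suc n} zero    v zero    = v zero
pad {suc n} zero    v (suc j) = pad zero (tail v) j

pad-< : ∀ {n} k (v : Vector ℚ n) {j} → j < k → pad k v j ≡ 0ℚ
pad-< (suc k) v {zero}  j<k = refl
pad-< (suc k) v {suc j} j<k = pad-< k v (s<s⁻¹ j<k)

pad-toℕ : ∀ {n} k (v : Vector ℚ n) j → pad k v (k + toℕ j) ≡ v j
pad-toℕ (suc k) v j       = pad-toℕ k v j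
pad-toℕ zero    v zero    = refl
pad-toℕ zero    v (suc j) = pad-toℕ zero (tail v) j

pad-≥ : ∀ {n} k (v : Vector ℚ n) {j} → k + n ≤ j → pad k v j ≡ 0ℚ
pad-≥         (suc k) v {suc j} p = pad-≥ k v (s≤s⁻¹ p)
pad-≥ {zero}  zero    v p         = refl
pad-≥ {suc n} zero    v {suc j} p = pad-≥ zero (tail v) (s≤s⁻¹ p)

-- Entries of the matrix.

-- The index is off by one: `band k x` belongs to distance `suc x` from the diagonal.
band : ℕ → ℕ → ℚ
band k x = if suc x ≤ᵇ k then 1ℚ else 0ℚ

band-< : ∀ {k x} → x < k → band k x ≡ 1ℚ
band-< {k} {x} x<k with suc x ≤ᵇ k | ≤⇒≤ᵇ x<k
... | true | _ = refl

band-≥ : ∀ {k x} → k ≤ x → band k x ≡ 0ℚ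
band-≥ {k} {x} k≤x with suc x ≤ᵇ k in eq
... | false = refl
... | true  = contradiction (≤ᵇ⇒≤ (suc x) k (subst T (sym eq) _)) (≤⇒≯ k≤x)

diagonalEntry-right : ∀ k m x → diagonalEntry k ((m + suc x) ℤ.⊖ m) ≡ band k x
diagonalEntry-right k m x =
  cong (diagonalEntry k)
    (trans (cong ((m + suc x) ℤ.⊖_) (sym (+-identityʳ m))) (ℤ.+-cancelˡ-⊖ m (suc x) 0))

diagonalEntry-left : ∀ k m x → diagonalEntry k (m ℤ.⊖ (m + suc x)) ≡ ℚ.- band k x
diagonalEntry-left k m x =
  cong (diagonalEntry k)
    (trans (cong (ℤ._⊖ (m + suc x)) (sym (+-identityʳ m))) (ℤ.+-cancelˡ-⊖ m 0 (suc x)))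

diagonalEntry-diag : ∀ k m → diagonalEntry k (m ℤ.⊖ m) ≡ 0ℚ
diagonalEntry-diag k m = cong (diagonalEntry k) (ℤ.n⊖n≡0 m)

-- Window sums and the rows of the matrix.

window : ℕ → (ℕ → ℚ) → ℕ → ℚ
window k f j = ∑< k (λ x → f (j + x))

-- Both sides are the sum of the `k + 1` consecutive terms from `j` on.
window-shift : ∀ k f j → f j ℚ.+ window k f (suc j) ≡ window k f j ℚ.+ f (j + k)
window-shift k f j = begin
  f j ℚ.+ window k f (suc j)
    ≡⟨ cong₂ ℚ._+_ (cong f (sym (+-identityʳ j)))
                   (∑<-cong k (λ x _ → cong f (sym (+-suc j x)))) ⟩
  window (suc k) f j
    ≡⟨ ∑<-last k (λ x → f (j + x)) ⟩
  window k f j ℚ.+ f (j + k) ∎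

-- The columns split around the diagonal position `m + k`: `m` entries 0 beyond the band, `k`
-- entries -1, the diagonal 0, `k` entries 1, and `r` entries 0.
band-sum : ∀ k r m (f : ℕ → ℚ) →
  ∑< (m + (k + (1 + (k + r)))) (λ j → diagonalEntry k (j ℤ.⊖ (m + k)) ℚ.* f j)
    ≡ window k f (m + suc k) ℚ.- window k f m
band-sum k r m f = begin
  ∑< (m + (k + (1 + (k + r)))) g
    ≡⟨ ∑<-+ m _ g ⟩
  ∑< m g ℚ.+ ∑< (k + (1 + (k + r))) (λ x → g (m + x))
    ≡⟨ cong₂ ℚ._+_ far-left (∑<-+ k _ (λ x → g (m + x))) ⟩
  0ℚ ℚ.+ (∑< k (λ x → g (m + x)) ℚ.+ (g (m + (k + 0)) ℚ.+ ∑< (k + r) (λ x → g (m + (k + suc x)))))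
    ≡⟨ cong (0ℚ ℚ.+_) (cong₂ ℚ._+_ near-left (cong₂ ℚ._+_ middle (∑<-+ k r (λ x → g (m + (k + suc x)))))) ⟩
  0ℚ ℚ.+ (ℚ.- window k f m ℚ.+ (0ℚ ℚ.+ (∑< k (λ x → g (m + (k + suc x))) ℚ.+
    ∑< r (λ x → g (m + (k + suc (k + x)))))))
    ≡⟨ cong (λ z → 0ℚ ℚ.+ (ℚ.- window k f m ℚ.+ (0ℚ ℚ.+ z))) (cong₂ ℚ._+_ near-right far-right) ⟩
  0ℚ ℚ.+ (ℚ.- window k f m ℚ.+ (0ℚ ℚ.+ (window k f (m + suc k) ℚ.+ 0ℚ)))
    ≡⟨ solve 2 (λ a b → con 0ℚ :+ (:- a :+ (con 0ℚ :+ (b :+ con 0ℚ))) := b :- a) refl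
         (window k f m) (window k f (m + suc k)) ⟩
  window k f (m + suc k) ℚ.- window k f m ∎
  where
  open ℚ.+-*-Solver

  e : ℕ → ℚ
  e j = diagonalEntry k (j ℤ.⊖ (m + k))

  g : ℕ → ℚ
  g j = e j ℚ.* f j

  zero-entry : ∀ j → e j ≡ 0ℚ → g j ≡ 0ℚ
  zero-entry j eq = trans (cong (ℚ._* f j) eq) (ℚ.*-zeroˡ (f j))

  right : ∀ x → e (m + (k + suc x)) ≡ band k x
  right x = trans (cong e (sym (+-assoc m k (suc x)))) (diagonalEntry-right k (m + k) x)

  far-left : ∑< m g ≡ 0ℚ
  far-left = ∑<-zero m λ x x<m → zero-entry x (beyond x x<m)
    where
    beyond : ∀ x → x < m → e x ≡ 0ℚ
    beyond x x<m with m≤n⇒∃[o]m+o≡n x<m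
    ... | d , refl = begin
      diagonalEntry k (x ℤ.⊖ (suc x + d + k))
        ≡⟨ cong (λ z → diagonalEntry k (x ℤ.⊖ z))
             (trans (cong suc (+-assoc x d k)) (sym (+-suc x (d + k)))) ⟩
      diagonalEntry k (x ℤ.⊖ (x + suc (d + k)))
        ≡⟨ diagonalEntry-left k x (d + k) ⟩
      ℚ.- band k (d + k)
        ≡⟨ cong ℚ.-_ (band-≥ (m≤n+m k d)) ⟩
      0ℚ ∎

  near-left : ∑< k (λ x → g (m + x)) ≡ ℚ.- window k f m
  near-left = trans (∑<-cong k term) (∑<-neg k (λ x → f (m + x)))
    where
    entry : ∀ x → x < k → e (m + x) ≡ ℚ.- 1ℚ
    entry x x<k with m≤n⇒∃[o]m+o≡n x<k
    ... | d , refl = begin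
      diagonalEntry (suc x + d) ((m + x) ℤ.⊖ (m + (suc x + d)))
        ≡⟨ cong (λ z → diagonalEntry (suc x + d) ((m + x) ℤ.⊖ z))
             (trans (cong (λ z → m + z) (sym (+-suc x d))) (sym (+-assoc m x (suc d)))) ⟩
      diagonalEntry (suc x + d) ((m + x) ℤ.⊖ (m + x + suc d))
        ≡⟨ diagonalEntry-left (suc x + d) (m + x) d ⟩
      ℚ.- band (suc x + d) d
        ≡⟨ cong ℚ.-_ (band-< (s≤s (m≤n+m d x))) ⟩
      ℚ.- 1ℚ ∎

    term : ∀ x → x < k → g (m + x) ≡ ℚ.- f (m + x)
    term x x<k = trans (cong (ℚ._* f (m + x)) (entry x x<k))
      (solve 1 (λ a → (:- con 1ℚ) :* a := :- a) refl (f (m + x)))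

  middle : g (m + (k + 0)) ≡ 0ℚ
  middle = zero-entry _ (trans (cong (λ z → e (m + z)) (+-identityʳ k)) (diagonalEntry-diag k (m + k)))

  near-right : ∑< k (λ x → g (m + (k + suc x))) ≡ window k f (m + suc k)
  near-right = ∑<-cong k λ x x<k → begin
    g (m + (k + suc x))
      ≡⟨ cong (ℚ._* f (m + (k + suc x))) (trans (right x) (band-< x<k)) ⟩
    1ℚ ℚ.* f (m + (k + suc x))
      ≡⟨ ℚ.*-identityˡ _ ⟩
    f (m + (k + suc x))
      ≡⟨ cong f (trans (cong (λ z → m + z) (+-suc k x)) (sym (+-assoc m (suc k) x))) ⟩
    f (m + suc k + x) ∎

  far-right : ∑< r (λ x → g (m + (k + suc (k + x)))) ≡ 0ℚ
  far-right = ∑<-zero r λ x _ → zero-entry _ (trans (right (k + x)) (band-≥ (m≤m+n k x)))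

-- Adding `k` zeros on each side of `v` leaves the sum unchanged and gives every row a band of full
-- width, so that `band-sum` applies with the diagonal at `toℕ i + k`.
A-row : ∀ {n} k (v : Vector ℚ n) i →
  ∑ (λ j → A n k i j ℚ.* v j)
    ≡ window k (pad k v) (toℕ i + suc k) ℚ.- window k (pad k v) (toℕ i)
A-row {n} k v i with m≤n⇒∃[o]m+o≡n (toℕ<n i)
-- Here `r` counts the columns to the right of the diagonal.
... | r , i+1+r≡n = begin
  ∑ (λ j → A n k i j ℚ.* v j)
    ≡⟨ sum-cong-≗ (λ j → cong₂ ℚ._*_
         (cong (diagonalEntry k)
           (trans (sym (ℤ.+-cancelˡ-⊖ k (toℕ j) (toℕ i))) (cong ((k + toℕ j) ℤ.⊖_) (+-comm k (toℕ i)))))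
         (sym (pad-toℕ k v j))) ⟩
  ∑< n (λ x → g (k + x))
    ≡⟨ trans (ℚ.+-identityˡ _) (ℚ.+-identityʳ _) ⟨
  0ℚ ℚ.+ (∑< n (λ x → g (k + x)) ℚ.+ 0ℚ)
    ≡⟨ cong₂ ℚ._+_
         (∑<-zero k (λ x x<k → vanish x (pad-< k v x<k)))
         (cong (∑< n (λ x → g (k + x)) ℚ.+_)
           (∑<-zero k (λ x x<k → vanish _ (pad-≥ k v (+-monoʳ-≤ k (m≤m+n n x)))))) ⟨
  ∑< k g ℚ.+ (∑< n (λ x → g (k + x)) ℚ.+ ∑< k (λ x → g (k + (n + x))))
    ≡⟨ cong (∑< k g ℚ.+_) (∑<-+ n k (λ x → g (k + x))) ⟨
  ∑< k g ℚ.+ ∑< (n + k) (λ x → g (k + x))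
    ≡⟨ ∑<-+ k (n + k) g ⟨
  ∑< (k + (n + k)) g
    ≡⟨ cong (λ l → ∑< l g) lengths ⟩
  ∑< (toℕ i + (k + (1 + (k + r)))) g
    ≡⟨ band-sum k r (toℕ i) (pad k v) ⟩
  window k (pad k v) (toℕ i + suc k) ℚ.- window k (pad k v) (toℕ i) ∎
  where
  g : ℕ → ℚ
  g j = diagonalEntry k (j ℤ.⊖ (toℕ i + k)) ℚ.* pad k v j

  vanish : ∀ j → pad k v j ≡ 0ℚ → g j ≡ 0ℚ
  vanish j eq = trans (cong (diagonalEntry k (j ℤ.⊖ (toℕ i + k)) ℚ.*_) eq) (ℚ.*-zeroʳ (diagonalEntry k (j ℤ.⊖ (toℕ i + k))))

  lengths : k + (n + k) ≡ toℕ i + (k + (1 + (k + r)))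
  lengths = trans (cong (λ l → k + (l + k)) (sym i+1+r≡n)) (shape k (toℕ i) r)
    where
    open ℕ.+-*-Solver
    shape : ∀ k i r → k + (suc i + r + k) ≡ i + (k + (1 + (k + r)))
    shape = solve 3 (λ k i r → k :+ ((con 1 :+ i :+ r) :+ k)
                       := i :+ (k :+ (con 1 :+ (k :+ r)))) refl

-- Periodic sequences and their windows.

Periodic : ℕ → (ℕ → ℚ) → Set
Periodic p f = ∀ y → f (y + p) ≡ f y

-- An index below `N + p` is either below `p` or reached by a step from an index below `N`, so the
-- descent to the residue only uses steps that the hypothesis grants.
steps⇒mod : ∀ p .{{_ : NonZero p}} N (f : ℕ → ℚ) →
  (∀ y → y < N → f (y + p) ≡ f y) → ∀ y → y < N + p → f y ≡ f (y % p)
steps⇒mod p N f step y y<N+p =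
  trans (cong f (m≡m%n+[m/n]*n y p))
    (climb (y / p) (y % p) (subst (_< N + p) (m≡m%n+[m/n]*n y p) y<N+p))
  where
  climb : ∀ m r → r + m * p < N + p → f (r + m * p) ≡ f r
  climb zero    r _     = cong f (+-identityʳ r)
  climb (suc m) r bound = begin
    f (r + (p + m * p)) ≡⟨ cong f shape ⟩
    f (r + m * p + p)   ≡⟨ step _ below ⟩
    f (r + m * p)       ≡⟨ climb m r (≤-trans below (m≤m+n N p)) ⟩
    f r                 ∎
    where
    shape : r + (p + m * p) ≡ r + m * p + p
    shape = trans (cong (λ z → r + z) (+-comm p (m * p))) (sym (+-assoc r (m * p) p))

    below : r + m * p < N
    below = +-cancelʳ-< p (r + m * p) N (subst (_< N + p) shape bound)

periodic-mod : ∀ {p} .{{_ : NonZero p}} {f} → Periodic p f → ∀ y → f y ≡ f (y % p)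
periodic-mod {p} {f = f} per y = steps⇒mod p (suc y) f (λ x _ → per x) y (s≤s (m≤m+n y p))

mod-periodic : ∀ {p} .{{_ : NonZero p}} {f} → (∀ y → f y ≡ f (y % p)) → Periodic p f
mod-periodic {p} {f} eq y = begin
  f (y + p)       ≡⟨ eq (y + p) ⟩
  f ((y + p) % p) ≡⟨ cong f ([m+n]%n≡m%n y p) ⟩
  f (y % p)       ≡⟨ eq y ⟨
  f y             ∎

periodic-∣ : ∀ {p m f} → Periodic p f → p ∣ m → ∀ y → f (y + m) ≡ f y
periodic-∣ {p} {f = f} per (divides-refl q) y = go q
  where
  go : ∀ q → f (y + q * p) ≡ f y
  go zero    = cong f (+-identityʳ y)
  go (suc q) = begin
    f (y + (p + q * p)) ≡⟨ cong (λ z → f (y + z)) (+-comm p (q * p)) ⟩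
    f (y + (q * p + p)) ≡⟨ cong f (+-assoc y (q * p) p) ⟨
    f (y + q * p + p)   ≡⟨ per _ ⟩
    f (y + q * p)       ≡⟨ go q ⟩
    f y                 ∎

-- Congruence modulo `p` enters as an equation without subtraction, a form that a ring solver can
-- check over the natural numbers.
periodic-≡ : ∀ {p a b f} → Periodic p f → p ∣ a → p ∣ b →
  ∀ y z → y + a ≡ z + b → f y ≡ f z
periodic-≡ {f = f} per p∣a p∣b y z eq =
  trans (sym (periodic-∣ {f = f} per p∣a y)) (trans (cong f eq) (periodic-∣ {f = f} per p∣b z))

-- A window as long as the period has constant sum: sliding it by one place drops `f j` and gains
-- the equal term `f (j + k)`.
window-periodic : ∀ {k f} → Periodic k f → ∀ m j → window k f (j + m) ≡ window k f j
window-periodic {k} {f} per zero    j = cong (window k f) (+-identityʳ j)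
window-periodic {k} {f} per (suc m) j = begin
  window k f (j + suc m)   ≡⟨ cong (window k f) (+-suc j m) ⟩
  window k f (suc (j + m)) ≡⟨ ∙-cancelˡ (f (j + m)) _ _ slide ⟩
  window k f (j + m)       ≡⟨ window-periodic {k} {f} per m j ⟩
  window k f j             ∎
  where
  slide : f (j + m) ℚ.+ window k f (suc (j + m)) ≡ f (j + m) ℚ.+ window k f (j + m)
  slide = begin
    f (j + m) ℚ.+ window k f (suc (j + m))   ≡⟨ window-shift k f (j + m) ⟩
    window k f (j + m) ℚ.+ f (j + m + k)     ≡⟨ cong (window k f (j + m) ℚ.+_) (per (j + m)) ⟩
    window k f (j + m) ℚ.+ f (j + m)         ≡⟨ ℚ.+-comm _ (f (j + m)) ⟩
    f (j + m) ℚ.+ window k f (j + m)         ∎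

window-- : ∀ k (f g : ℕ → ℚ) j →
  window k (λ x → f x ℚ.- g x) j ≡ window k f j ℚ.- window k g j
window-- k f g j =
  trans (∑-distrib-+ {k} (λ x → f (j + toℕ x)) (λ x → ℚ.- g (j + toℕ x)))
        (cong (window k f j ℚ.+_) (∑<-neg k (λ x → g (j + x))))

-- The kernel in terms of sequences of period k + 1.

defect : (k : ℕ) .{{_ : NonZero k}} → (ℕ → ℚ) → ℕ → ℚ
defect k η j = η (j % k) ℚ.- η j

-- With v = defectVector n k η this says that defect k η vanishes on the k places following v;
-- on the k places preceding it, the indices j < k, it vanishes automatically.
Closes : (n k : ℕ) .{{_ : NonZero k}} → (ℕ → ℚ) → Set
Closes n k η = ∀ e → e < k → η ((k + n + e) % k) ≡ η (k + n + e)

defect-0 : ∀ k .{{_ : NonZero k}} η j → η (j % k) ≡ η j → defect k η j ≡ 0ℚ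
defect-0 k η j eq = trans (cong (ℚ._- η j) eq) (ℚ.+-inverseʳ (η j))

defectVector : (n k : ℕ) .{{_ : NonZero k}} → (ℕ → ℚ) → Vector ℚ n
defectVector n k η l = defect k η (k + toℕ l)

-- Before the vector both sides vanish because `j % k` is `j`, on the vector they agree by
-- definition, and after it `Closes` makes the defect zero.
pad-defect : ∀ n k .{{_ : NonZero k}} η → Closes n k η →
  ∀ j → j < k + n + k → pad k (defectVector n k η) j ≡ defect k η j
pad-defect n k η closes j bound with j <? k
... | yes j<k =
  trans (pad-< k (defectVector n k η) j<k) (sym (defect-0 k η j (cong η (m<n⇒m%n≡m j<k))))
... | no j≮k with m≤n⇒∃[o]m+o≡n (≮⇒≥ j≮k)
...   | x , refl with x <? n
...     | yes x<n =
  subst (λ z → pad k (defectVector n k η) (k + z) ≡ defect k η (k + z)) (toℕ-fromℕ< x<n)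
    (pad-toℕ k (defectVector n k η) (fromℕ< x<n))
...     | no x≮n with m≤n⇒∃[o]m+o≡n (≮⇒≥ x≮n)
...       | e , refl =
  trans (pad-≥ k (defectVector n k η) (+-monoʳ-≤ k (m≤m+n n e)))
    (sym (defect-0 k η (k + (n + e))
      (subst (λ z → η (z % k) ≡ η z) (+-assoc k n e) (closes e e<k))))
  where
  e<k : e < k
  e<k = +-cancelˡ-< (k + n) e k (subst (_< k + n + k) (sym (+-assoc k n e)) bound)

-- A shift by `k + 1` changes no window of the defect: the summand of period `k` has constant
-- windows of length `k`, and the other one has period `k + 1`.
periodic⇒inKernel : ∀ n k .{{_ : NonZero k}} η → Periodic (suc k) η → Closes n k η →
  InKernel (A n k) (defectVector n k η)
periodic⇒inKernel n k η per closes i = begin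
  ∑ (λ j → A n k i j ℚ.* v j)
    ≡⟨ A-row k v i ⟩
  window k (pad k v) (toℕ i + suc k) ℚ.- window k (pad k v) (toℕ i)
    ≡⟨ cong (ℚ._- window k (pad k v) (toℕ i)) same ⟩
  window k (pad k v) (toℕ i) ℚ.- window k (pad k v) (toℕ i)
    ≡⟨ ℚ.+-inverseʳ (window k (pad k v) (toℕ i)) ⟩
  0ℚ ∎
  where
  v : Vector ℚ n
  v = defectVector n k η

  i≤n : suc (toℕ i) ≤ n
  i≤n = toℕ<n i

  same : window k (pad k v) (toℕ i + suc k) ≡ window k (pad k v) (toℕ i)
  same = begin
    window k (pad k v) (toℕ i + suc k)
      ≡⟨ ∑<-cong k (λ x x<k → pad-defect n k η closes _
           (+-mono-≤-< (subst (_≤ k + n) (sym (+-suc (toℕ i) k))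
             (subst (suc (toℕ i) + k ≤_) (+-comm n k) (+-monoˡ-≤ k i≤n))) x<k)) ⟩
    window k (defect k η) (toℕ i + suc k)
      ≡⟨ window-- k (η ∘ (_% k)) η (toℕ i + suc k) ⟩
    window k (η ∘ (_% k)) (toℕ i + suc k) ℚ.- window k η (toℕ i + suc k)
      ≡⟨ cong₂ ℚ._-_
           (window-periodic {k} {η ∘ (_% k)} (λ y → cong η ([m+n]%n≡m%n y k)) (suc k) (toℕ i))
           (∑<-cong k (λ x _ → trans (cong η (shape x)) (per (toℕ i + x)))) ⟩
    window k (η ∘ (_% k)) (toℕ i) ℚ.- window k η (toℕ i)
      ≡⟨ window-- k (η ∘ (_% k)) η (toℕ i) ⟨
    window k (defect k η) (toℕ i)
      ≡⟨ ∑<-cong k (λ x x<k → pad-defect n k η closes _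
           (+-mono-≤-< (≤-trans (<⇒≤ i≤n) (m≤n+m n k)) x<k)) ⟨
    window k (pad k v) (toℕ i) ∎
    where
    shape : ∀ x → toℕ i + suc k + x ≡ toℕ i + x + suc k
    shape x = trans (+-assoc (toℕ i) (suc k) x)
      (trans (cong (λ z → toℕ i + z) (+-comm (suc k) x)) (sym (+-assoc (toℕ i) x (suc k))))

-- The kernel equations give the window sums the step `k + 1`. With this, `window-shift` says that
-- `W j + S (suc j)` does not change under `j ↦ j + k`, and the leading zeros of `W` identify its
-- value with `η (j % k)`.
inKernel⇒periodic : ∀ n k .{{_ : NonZero k}} (v : Vector ℚ n) → InKernel (A n k) v →
  ∃ λ η → Periodic (suc k) η × η k ≡ 0ℚ × Closes n k η × (∀ l → v l ≡ defectVector n k η l)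
inKernel⇒periodic n k v ker =
  η , per , ηk≡0 ,
  (λ e e<k → sym (x∙y⁻¹≈ε⇒x≈y _ _ (begin
     η (k + n + e) ℚ.- η ((k + n + e) % k)
       ≡⟨ solve 2 (λ a b → a :- b := :- (b :- a)) refl (η (k + n + e)) (η ((k + n + e) % k)) ⟩
     ℚ.- defect k η (k + n + e)
       ≡⟨ cong ℚ.-_ (W≡ _ (+-monoʳ-< (k + n) e<k)) ⟨
     ℚ.- W (k + n + e)
       ≡⟨ cong ℚ.-_ (pad-≥ k v (m≤m+n (k + n) e)) ⟩
     0ℚ ∎))) ,
  (λ l → trans (sym (pad-toℕ k v l))
           (W≡ _ (≤-trans (+-monoʳ-< k (toℕ<n l)) (m≤m+n (k + n) k))))
  where
  open ℚ.+-*-Solver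

  W : ℕ → ℚ
  W = pad k v

  S : ℕ → ℚ
  S = window k W

  S-step : ∀ j → j < n → S (j + suc k) ≡ S j
  S-step j j<n = subst (λ z → S (z + suc k) ≡ S z) (toℕ-fromℕ< j<n)
    (x∙y⁻¹≈ε⇒x≈y _ _ (trans (sym (A-row k v (fromℕ< j<n))) (ker (fromℕ< j<n))))

  -- The (k + 1)-periodic continuation of S beyond the range where the kernel equations apply.
  g : ℕ → ℚ
  g j = S (j % suc k)

  S≡g : ∀ j → j < n + suc k → S j ≡ g j
  S≡g = steps⇒mod (suc k) n S S-step

  g-periodic : Periodic (suc k) g
  g-periodic y = cong S ([m+n]%n≡m%n y (suc k))

  -- The shift by one turns the empty window at 0, which lies in the leading zeros, into the
  -- normalization `η k ≡ 0ℚ`.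
  η : ℕ → ℚ
  η y = g (suc y)

  per : Periodic (suc k) η
  per y = g-periodic (suc y)

  ηk≡0 : η k ≡ 0ℚ
  ηk≡0 = trans (g-periodic 0) (∑<-zero k (λ x x<k → pad-< k v x<k))

  -- This is the quantity that the window shift preserves along steps of length `k`.
  D : ℕ → ℚ
  D j = W j ℚ.+ η j

  D-step : ∀ j → j < k + n → D (j + k) ≡ D j
  D-step j j<k+n = begin
    W (j + k) ℚ.+ η (j + k)        ≡⟨ cong (λ z → W (j + k) ℚ.+ g z) (sym (+-suc j k)) ⟩
    W (j + k) ℚ.+ g (j + suc k)    ≡⟨ cong (W (j + k) ℚ.+_) (trans (g-periodic j) (sym (S≡g j (<-trans (n<1+n j) sj<)))) ⟩
    W (j + k) ℚ.+ S j              ≡⟨ ℚ.+-comm (W (j + k)) (S j) ⟩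
    S j ℚ.+ W (j + k)              ≡⟨ window-shift k W j ⟨
    W j ℚ.+ S (suc j)              ≡⟨ cong (W j ℚ.+_) (S≡g (suc j) sj<) ⟩
    W j ℚ.+ η j                    ∎
    where
    sj< : suc j < n + suc k
    sj< = subst (suc j <_) (trans (cong suc (+-comm k n)) (sym (+-suc n k))) (s≤s j<k+n)

  W≡ : ∀ j → j < k + n + k → W j ≡ defect k η j
  W≡ j bound = begin
    W j                           ≡⟨ solve 2 (λ a b → a := (a :+ b) :- b) refl (W j) (η j) ⟩
    D j ℚ.- η j                   ≡⟨ cong (ℚ._- η j) (steps⇒mod k (k + n) D D-step j bound) ⟩
    D (j % k) ℚ.- η j             ≡⟨ cong (λ z → z ℚ.+ η (j % k) ℚ.- η j) (pad-< k v (m%n<n j k)) ⟩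
    0ℚ ℚ.+ η (j % k) ℚ.- η j      ≡⟨ cong (ℚ._- η j) (ℚ.+-identityˡ (η (j % k))) ⟩
    defect k η j                  ∎

-- Unit vectors and linear combinations.

unit : ∀ {d} → Fin d → Vector ℚ d
unit zero    zero    = 1ℚ
unit zero    (suc m) = 0ℚ
unit (suc l) zero    = 0ℚ
unit (suc l) (suc m) = unit l m

pad-zero : ∀ o {d} j → pad {d} o (λ _ → 0ℚ) j ≡ 0ℚ
pad-zero (suc o)         zero    = refl
pad-zero (suc o)         (suc j) = pad-zero o j
pad-zero zero    {zero}  j       = refl
pad-zero zero    {suc d} zero    = refl
pad-zero zero    {suc d} (suc j) = pad-zero zero {d} j

∑-*-0 : ∀ {d} (c : Vector ℚ d) → ∑ (λ l → c l ℚ.* 0ℚ) ≡ 0ℚ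
∑-*-0 {zero}  c = refl
∑-*-0 {suc d} c = cong₂ ℚ._+_ (ℚ.*-zeroʳ (c zero)) (∑-*-0 (tail c))

pad-units : ∀ {d} o (c : Vector ℚ d) j → ∑ (λ l → c l ℚ.* pad o (unit l) j) ≡ pad o c j
pad-units         (suc o) c zero    = ∑-*-0 c
pad-units         (suc o) c (suc j) = pad-units o c j
pad-units {zero}  zero    c j       = refl
pad-units {suc d} zero    c zero    =
  trans (cong₂ ℚ._+_ (ℚ.*-identityʳ (c zero)) (∑-*-0 (tail c))) (ℚ.+-identityʳ (c zero))
pad-units {suc d} zero    c (suc j) = begin
  c zero ℚ.* pad zero (λ (_ : Fin d) → 0ℚ) j ℚ.+ ∑ (λ l → c (suc l) ℚ.* pad zero (unit l) j)
    ≡⟨ cong₂ ℚ._+_ (trans (cong (c zero ℚ.*_) (pad-zero zero {d} j)) (ℚ.*-zeroʳ (c zero)))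
                   (pad-units zero (tail c) j) ⟩
  0ℚ ℚ.+ pad zero (tail c) j
    ≡⟨ ℚ.+-identityˡ _ ⟩
  pad zero (tail c) j ∎

-- The defect is linear in `η`.
linComb-defect : ∀ {d} k .{{_ : NonZero k}} (c : Vector ℚ d) (ηs : Fin d → ℕ → ℚ) (η : ℕ → ℚ) →
  (∀ y → ∑ (λ l → c l ℚ.* ηs l y) ≡ η y) →
  ∀ j → ∑ (λ l → c l ℚ.* defect k (ηs l) j) ≡ defect k η j
linComb-defect {d} k c ηs η comb j = begin
  ∑ (λ l → c l ℚ.* defect k (ηs l) j)
    ≡⟨ sum-cong-≗
         (λ l → solve 3 (λ a b e → a :* (b :- e) := a :* b :+ (:- con 1ℚ) :* (a :* e)) refl
                  (c l) (ηs l (j % k)) (ηs l j)) ⟩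
  ∑ (λ l → c l ℚ.* ηs l (j % k) ℚ.+ (ℚ.- 1ℚ) ℚ.* (c l ℚ.* ηs l j))
    ≡⟨ ∑-distrib-+ (λ l → c l ℚ.* ηs l (j % k)) _ ⟩
  ∑ (λ l → c l ℚ.* ηs l (j % k)) ℚ.+ ∑ (λ l → (ℚ.- 1ℚ) ℚ.* (c l ℚ.* ηs l j))
    ≡⟨ cong₂ ℚ._+_ (comb (j % k))
         (trans (sym (*-distribˡ-sum (ℚ.- 1ℚ) (λ l → c l ℚ.* ηs l j))) (cong ((ℚ.- 1ℚ) ℚ.*_) (comb j))) ⟩
  η (j % k) ℚ.+ (ℚ.- 1ℚ) ℚ.* η j
    ≡⟨ solve 2 (λ a b → a :+ (:- con 1ℚ) :* b := a :- b) refl (η (j % k)) (η j) ⟩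
  defect k η j ∎
  where open ℚ.+-*-Solver

-- The nullity as a number of free residues modulo t + 1.

-- The residues up to `t` represent the cycles of the rotation by `t + 1`; those from `o` to below
-- `o + d` are the free coordinates.
Supported : (t o d : ℕ) → (ℕ → ℚ) → Set
Supported t o d η = ∀ r → r ≤ t → r < o ⊎ o + d ≤ r → η r ≡ 0ℚ

-- Since `η (t + suc r)` is `η r` by periodicity, the equations form a chain through `η t`, `η 0`,
-- `η 1` and so on, which starts at zero.
vanish-upwards : ∀ {t η} → Periodic (suc t) η → η t ≡ 0ℚ → ∀ m →
  (∀ r → r < m → η r ≡ η (t + r)) → ∀ r → r < m → η r ≡ 0ℚ
vanish-upwards {t} {η} per ηt≡0 m eq zero    r<m =
  trans (eq 0 r<m) (trans (cong η (+-identityʳ t)) ηt≡0)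
vanish-upwards {t} {η} per ηt≡0 m eq (suc r) r<m = begin
  η (suc r)       ≡⟨ eq (suc r) r<m ⟩
  η (t + suc r)   ≡⟨ cong η (trans (+-suc t r) (+-comm (suc t) r)) ⟩
  η (r + suc t)   ≡⟨ per r ⟩
  η r             ≡⟨ vanish-upwards per ηt≡0 m eq r (<-trans (n<1+n r) r<m) ⟩
  0ℚ              ∎

suc-∣⇒≤ : ∀ {t k} → suc t ∣ suc k → t ≤ k
suc-∣⇒≤ s∣P = s≤s⁻¹ (∣⇒≤ s∣P)

-- Both `k` and `t` are -1 modulo `suc t`.
periodic-k+ : ∀ {t k η} → suc t ∣ suc k → Periodic (suc t) η → ∀ r → η (k + r) ≡ η (t + r)
periodic-k+ {t} {k} {η} s∣P per r = periodic-≡ {f = η} per ∣-refl s∣P (k + r) (t + r) (shape k r t)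
  where
  open ℕ.+-*-Solver
  shape : ∀ k r t → k + r + suc t ≡ t + r + suc k
  shape = solve 3 (λ k r t → k :+ r :+ (con 1 :+ t) := t :+ r :+ (con 1 :+ k)) refl

-- The two hypotheses identify the admissible `η` with arbitrary values on `d` residues, and unit
-- vectors there give the basis. Constant sequences have zero defect; `o + d ≤ t` forces the value 0
-- at residue `t`, which rules them out and yields independence.
nullity : ∀ t o d n k .{{_ : NonZero k}} → o + d ≤ t → suc t ∣ suc k → k < n →
  (∀ η → Periodic (suc t) η → Supported t o d η → Closes n k η) →
  (∀ η → Periodic (suc k) η → η k ≡ 0ℚ → Closes n k η → Periodic (suc t) η × Supported t o d η) →
  HasNullity (A n k) d
nullity t o d n k o+d≤t s∣P k<n closes supported = basis , record
  { inKernel    = λ l → periodic⇒inKernel n k (spread (unit l))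
      (λ y → periodic-∣ {f = spread (unit l)} (spread-periodic (unit l)) s∣P y)
      (closes (spread (unit l)) (spread-periodic (unit l)) (spread-supported (unit l)))
  ; independent = independent
  ; spanning    = spanning
  }
  where
  spread : Vector ℚ d → ℕ → ℚ
  spread c y = pad o c (y % suc t)

  spread-periodic : ∀ c → Periodic (suc t) (spread c)
  spread-periodic c y = cong (pad o c) ([m+n]%n≡m%n y (suc t))

  spread-≤ : ∀ c {r} → r ≤ t → spread c r ≡ pad o c r
  spread-≤ c r≤t = cong (pad o c) (m≤n⇒m%n≡m r≤t)

  spread-supported : ∀ c → Supported t o d (spread c)
  spread-supported c r r≤t (inj₁ r<o)   = trans (spread-≤ c r≤t) (pad-< o c r<o)
  spread-supported c r r≤t (inj₂ o+d≤r) = trans (spread-≤ c r≤t) (pad-≥ o c o+d≤r)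

  basis : Fin d → Vector ℚ n
  basis l = defectVector n k (spread (unit l))

  linComb-basis : ∀ c j → linComb c basis j ≡ defectVector n k (spread c) j
  linComb-basis c j =
    linComb-defect k c (spread ∘ unit) (spread c) (λ y → pad-units o c (y % suc t)) (k + toℕ j)

  o+l<t : ∀ (l : Fin d) → o + toℕ l < t
  o+l<t l = ≤-trans (+-monoʳ-< o (toℕ<n l)) o+d≤t

  independent : LinearlyIndependent basis
  independent c c≡0 l = begin
    c l                    ≡⟨ pad-toℕ o c l ⟨
    pad o c (o + toℕ l)    ≡⟨ spread-≤ c (<⇒≤ (o+l<t l)) ⟨
    spread c (o + toℕ l)   ≡⟨ vanish-upwards {η = spread c} (spread-periodic c)
                                (spread-supported c t ≤-refl (inj₂ o+d≤t)) t flat _ (o+l<t l) ⟩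
    0ℚ                     ∎
    where
    -- Coordinate `r` of the vanishing combination compares `k + r` with its residue modulo `k`; it
    -- exists because `r < t ≤ k < n`.
    flat : ∀ r → r < t → spread c r ≡ spread c (t + r)
    flat r r<t = begin
      spread c r             ≡⟨ cong (spread c) (trans (%-remove-+ˡ r ∣-refl) (m<n⇒m%n≡m r<k)) ⟨
      spread c ((k + r) % k) ≡⟨ x∙y⁻¹≈ε⇒x≈y _ _ (subst (λ z → defect k (spread c) (k + z) ≡ 0ℚ) (toℕ-fromℕ< r<n)
                                  (trans (sym (linComb-basis c (fromℕ< r<n))) (c≡0 (fromℕ< r<n)))) ⟩
      spread c (k + r)       ≡⟨ periodic-k+ {η = spread c} s∣P (spread-periodic c) r ⟩
      spread c (t + r)       ∎
      where
      r<k = ≤-trans r<t (suc-∣⇒≤ s∣P)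
      r<n = <-trans r<k k<n

  span : ∀ v η → Periodic (suc t) η → Supported t o d η →
    (∀ j → v j ≡ defectVector n k η j) → ∃ λ c → ∀ j → v j ≡ linComb c basis j
  span v η pers supp v≡ = c , λ j → begin
    v j                                 ≡⟨ v≡ j ⟩
    defectVector n k η j                ≡⟨ cong₂ ℚ._-_ (η≡ ((k + toℕ j) % k)) (η≡ (k + toℕ j)) ⟩
    defectVector n k (spread c) j       ≡⟨ linComb-basis c j ⟨
    linComb c basis j                   ∎
    where
    c : Vector ℚ d
    c l = η (o + toℕ l)

    on-period : ∀ r → r ≤ t → η r ≡ pad o c r
    on-period r r≤t with r <? o
    ... | yes r<o = trans (supp r r≤t (inj₁ r<o)) (sym (pad-< o c r<o))
    ... | no  r≮o with m≤n⇒∃[o]m+o≡n (≮⇒≥ r≮o)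
    ...   | x , refl with x <? d
    ...     | yes x<d = subst (λ z → η (o + z) ≡ pad o c (o + z)) (toℕ-fromℕ< x<d)
                          (sym (pad-toℕ o c (fromℕ< x<d)))
    ...     | no  x≮d = trans (supp r r≤t (inj₂ o+d≤r)) (sym (pad-≥ o c o+d≤r))
      where o+d≤r = +-monoʳ-≤ o (≮⇒≥ x≮d)

    η≡ : ∀ y → η y ≡ spread c y
    η≡ y = trans (periodic-mod {f = η} pers y) (on-period (y % suc t) (m%n≤n′ y))
      where
      m%n≤n′ : ∀ y → y % suc t ≤ t
      m%n≤n′ y = s≤s⁻¹ (m%n<n y (suc t))

  spanning : ∀ v → InKernel (A n k) v → ∃ λ c → ∀ j → v j ≡ linComb c basis j
  spanning v ker =
    let η , perP , ηk≡0 , cl , v≡ = inKernel⇒periodic n k v ker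
        pers , supp = supported η perP ηk≡0 cl
    in span v η pers supp v≡

-- The rotation by t + 1 modulo k + 1.

-- On each cycle of the rotation by t + 1, all equations but one imply the remaining one.
steps⇒periodic : ∀ t Q k w η → suc t ∣ suc k → suc t + Q ≡ suc k → Periodic (suc k) η →
  (∀ x → x < Q → η (w + (x + suc t)) ≡ η (w + x)) → Periodic (suc t) η
steps⇒periodic t Q k w η s∣P s+Q≡P per step y = begin
  η (y + suc t)                   ≡⟨ rebase (y + suc t) ⟩
  f (y + suc t + w * k)           ≡⟨ cong f (trans (+-assoc y (suc t) (w * k))
                                       (trans (cong (λ z → y + z) (+-comm (suc t) (w * k))) (sym (+-assoc y (w * k) (suc t))))) ⟩
  f (y + w * k + suc t)           ≡⟨ mod-periodic {f = f} f-mod (y + w * k) ⟩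
  f (y + w * k)                   ≡⟨ rebase y ⟨
  η y                             ∎
  where
  f : ℕ → ℚ
  f x = η (w + x)

  f-per : Periodic (suc k) f
  f-per x = trans (cong η (sym (+-assoc w x (suc k)))) (per (w + x))

  -- The `Q` steps reach exactly `Q + suc t`, that is `suc k`, places: one full period of `f`.
  f-mod : ∀ x → f x ≡ f (x % suc t)
  f-mod x = begin
    f x                       ≡⟨ periodic-mod {f = f} f-per x ⟩
    f (x % suc k)             ≡⟨ steps⇒mod (suc t) Q f step (x % suc k)
                                   (subst (x % suc k <_) (trans (sym s+Q≡P) (+-comm (suc t) Q)) (m%n<n x (suc k))) ⟩
    f (x % suc k % suc t)     ≡⟨ cong f (m∣n⇒o%n%m≡o%m (suc t) (suc k) x s∣P) ⟩
    f (x % suc t)             ∎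

  -- As `k` is -1 modulo `suc k`, adding `w * k` subtracts `w` without leaving the natural numbers.
  rebase : ∀ y → η y ≡ f (y + w * k)
  rebase y = trans (sym (periodic-∣ {f = η} per (n∣m*n w) y)) (cong η (begin
    y + w * suc k     ≡⟨ cong (λ z → y + z) (*-suc w k) ⟩
    y + (w + w * k)   ≡⟨ sym (+-assoc y w (w * k)) ⟩
    y + w + w * k     ≡⟨ cong (_+ w * k) (+-comm y w) ⟩
    w + y + w * k     ≡⟨ +-assoc w y (w * k) ⟩
    w + (y + w * k)   ∎))

-- Modulo `k + 1` the product `suc t * k` is -(t + 1), so each equation is a backward step of the
-- rotation, and `Q` consecutive ones suffice.
returns⇒periodic : ∀ t Q o k η → t + Q ≡ k → suc t ∣ suc k → Periodic (suc k) η →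
  (∀ x → x < Q → η (o + x) ≡ η (suc t * k + (o + x))) → Periodic (suc t) η
returns⇒periodic t Q o k η refl s∣P per ret =
  -- The base point `Q + o` is `o` - (t + 1) modulo `suc k`, because `suc t + Q` is `suc k`.
  steps⇒periodic t Q (t + Q) (Q + o) η s∣P refl per λ x x<Q → begin
    η (Q + o + (x + suc t))             ≡⟨ cong η (shape₁ t Q o x) ⟩
    η (o + x + suc (t + Q))             ≡⟨ per (o + x) ⟩
    η (o + x)                           ≡⟨ ret x x<Q ⟩
    η (suc t * (t + Q) + (o + x))       ≡⟨ periodic-≡ {f = η} per (_ ∣0) (n∣m*n t) _ _ (shape₂ t Q o x) ⟩
    η (Q + o + x)                       ∎
  where
  open ℕ.+-*-Solver
  shape₁ : ∀ t Q o x → Q + o + (x + suc t) ≡ o + x + suc (t + Q)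
  shape₁ = solve 4 (λ t Q o x → Q :+ o :+ (x :+ (con 1 :+ t)) := o :+ x :+ (con 1 :+ (t :+ Q))) refl
  shape₂ : ∀ t Q o x → suc t * (t + Q) + (o + x) + 0 ≡ Q + o + x + t * suc (t + Q)
  shape₂ = solve 4 (λ t Q o x → (con 1 :+ t) :* (t :+ Q) :+ (o :+ x) :+ con 0
                      := Q :+ o :+ x :+ t :* (con 1 :+ (t :+ Q))) refl

-- The closing equations sorted by position.

-- The equations of Closes when k + n ≡ m k + a modulo k (k + 1), in terms of the position
-- relative to m k.
Returns : (m a k : ℕ) → (ℕ → ℚ) → Set
Returns m a k η =
  (∀ z → a ≤ z → z < k → η z ≡ η (m * k + z)) ×
  (∀ r → r < a → η r ≡ η (m * k + (k + r)))

[m*k+z]%k≡z : ∀ m k .{{_ : NonZero k}} z → z < k → (m * k + z) % k ≡ z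
[m*k+z]%k≡z m k z z<k = trans (%-remove-+ˡ z (n∣m*n m)) (m<n⇒m%n≡m z<k)

module _ (n k m a M : ℕ) .{{_ : NonZero k}} (η : ℕ → ℚ) (per : Periodic (suc k) η)
         (a≤k : a ≤ k) (k+n≡ : k + n ≡ m * k + a + M * (k * k + k)) where

  private
    open ℕ.+-*-Solver

    -- The term `M * (k * k + k)` is a multiple of both `k` and `suc k`; in this grouping it drops
    -- out of the residue modulo `k` and out of the value of `η`.
    index : ∀ e z → a + e ≡ z → k + n + e ≡ (m + M * suc k) * k + z
    index e z refl = trans (cong (λ y → y + e) k+n≡)
      (solve 5 (λ k m a M e → m :* k :+ a :+ M :* (k :* k :+ k) :+ e
                  := (m :+ M :* (con 1 :+ k)) :* k :+ (a :+ e)) refl k m a M e)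

    low-mod : ∀ e z → a + e ≡ z → z < k → η ((k + n + e) % k) ≡ η z
    low-mod e z eq z<k = cong η (trans (cong (_% k) (index e z eq)) ([m*k+z]%k≡z (m + M * suc k) k z z<k))

    high-mod : ∀ e r → a + e ≡ k + r → r < k → η ((k + n + e) % k) ≡ η r
    high-mod e r eq r<k = cong η (trans (cong (_% k) (trans (index e (k + r) eq) shape))
                                        ([m*k+z]%k≡z (suc (m + M * suc k)) k r r<k))
      where
      shape : (m + M * suc k) * k + (k + r) ≡ suc (m + M * suc k) * k + r
      shape = solve 3 (λ x k r → x :* k :+ (k :+ r) := (con 1 :+ x) :* k :+ r) refl (m + M * suc k) k r

    value : ∀ e z → a + e ≡ z → η (k + n + e) ≡ η (m * k + z)
    value e z eq = trans (cong η (index e z eq))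
      (periodic-≡ {f = η} per (_ ∣0) (n∣m*n (M * k)) _ _
        (solve 4 (λ k m M z → (m :+ M :* (con 1 :+ k)) :* k :+ z :+ con 0
                    := m :* k :+ z :+ M :* k :* (con 1 :+ k)) refl k m M z))

  -- The position `a + e` either stays below `k`, where the first half of `Returns` applies, or
  -- passes `k` once and lands at some `r < a`, where the second half does.
  returns⇒closes : Returns m a k η → Closes n k η
  returns⇒closes (low , high) e e<k with a + e <? k
  ... | yes z<k = trans (low-mod e _ refl z<k) (trans (low _ (m≤m+n a e) z<k) (sym (value e _ refl)))
  ... | no  z≮k =
    let r , k+r≡ = m≤n⇒∃[o]m+o≡n (≮⇒≥ z≮k)
        r<a = +-cancelˡ-< k r a (subst (_< k + a) (sym k+r≡) (subst (a + e <_) (+-comm a k) (+-monoʳ-< a e<k)))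
    in trans (high-mod e r (sym k+r≡) (≤-trans r<a a≤k))
         (trans (high r r<a) (sym (value e _ (sym k+r≡))))

  -- The index change is inverted: `e` is `z ∸ a` in the first half and `k ∸ a + r` in the second.
  closes⇒returns : Closes n k η → Returns m a k η
  closes⇒returns closes =
    (λ z a≤z z<k →
      let eq = m+[n∸m]≡n a≤z
      in trans (sym (low-mod (z ∸ a) z eq z<k))
           (trans (closes (z ∸ a) (≤-<-trans (m∸n≤m z a) z<k)) (value (z ∸ a) z eq))) ,
    (λ r r<a →
      let eq = trans (sym (+-assoc a (k ∸ a) r)) (cong (λ y → y + r) (m+[n∸m]≡n a≤k))
          e<k = subst (k ∸ a + r <_) (m∸n+n≡m a≤k) (+-monoʳ-< (k ∸ a) r<a)
      in trans (sym (high-mod (k ∸ a + r) r eq (≤-trans r<a a≤k)))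
           (trans (closes (k ∸ a + r) e<k) (value (k ∸ a + r) (k + r) eq)))

-- The two cases tk + i and tk - i.

periodic-s*k+ : ∀ {s η} → Periodic s η → ∀ k z → η (s * k + z) ≡ η z
periodic-s*k+ {s} {η} per k z =
  trans (cong η (+-comm (s * k) z)) (periodic-∣ {f = η} per (m∣m*n k) z)

periodic-k : ∀ {t k η} → suc t ∣ suc k → Periodic (suc t) η → η k ≡ η t
periodic-k {t} {k} {η} s∣P per =
  trans (cong η (sym (+-identityʳ k))) (trans (periodic-k+ {η = η} s∣P per 0) (cong η (+-identityʳ t)))

module _ (t i k : ℕ) (i≤t : i ≤ t) (s∣P : suc t ∣ suc k) (η : ℕ → ℚ) where

  -- The low equations are instances of the period. In the high ones both sides vanish, since modulo
  -- `suc t` the index `t + r` is `t` or `r` - 1, outside the free range.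
  supported⇒returns⁺ : Periodic (suc t) η → Supported t i (t ∸ i) η → Returns (suc t) i k η
  supported⇒returns⁺ per supp =
    (λ z _ _ → sym (periodic-s*k+ {η = η} per k z)) ,
    (λ r r<i → begin
      η r                       ≡⟨ supp r (≤-trans (<⇒≤ r<i) i≤t) (inj₁ r<i) ⟩
      0ℚ                        ≡⟨ after-t r r<i ⟨
      η (t + r)                 ≡⟨ periodic-k+ {η = η} s∣P per r ⟨
      η (k + r)                 ≡⟨ periodic-s*k+ {η = η} per k (k + r) ⟨
      η (suc t * k + (k + r))   ∎)
    where
    after-t : ∀ r → r < i → η (t + r) ≡ 0ℚ
    after-t zero    _   = trans (cong η (+-identityʳ t)) (supp t ≤-refl (inj₂ (≤-reflexive (m+[n∸m]≡n i≤t))))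
    after-t (suc r) r<i = begin
      η (t + suc r)   ≡⟨ cong η (trans (+-suc t r) (+-comm (suc t) r)) ⟩
      η (r + suc t)   ≡⟨ per r ⟩
      η r             ≡⟨ supp r (≤-trans (<⇒≤ r<i′) i≤t) (inj₁ r<i′) ⟩
      0ℚ              ∎
      where r<i′ = <-trans (n<1+n r) r<i

  -- As `i ≤ t`, the low equations include `k ∸ t` consecutive ones from `i` on, enough for the
  -- period. The high ones then carry the zero at `t` upwards through the residues below `i`.
  returns⇒supported⁺ : Periodic (suc k) η → η k ≡ 0ℚ → Returns (suc t) i k η →
    Periodic (suc t) η × Supported t i (t ∸ i) η
  returns⇒supported⁺ perP ηk≡0 (low , high) = per , supp
    where
    Q = k ∸ t

    t+Q≡k : t + Q ≡ k
    t+Q≡k = m+[n∸m]≡n (suc-∣⇒≤ s∣P)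

    per : Periodic (suc t) η
    per = returns⇒periodic t Q i k η t+Q≡k s∣P perP λ x x<Q →
      low (i + x) (m≤m+n i x) (subst (i + x <_) t+Q≡k (+-mono-≤-< i≤t x<Q))

    ηt≡0 : η t ≡ 0ℚ
    ηt≡0 = trans (sym (periodic-k {η = η} s∣P per)) ηk≡0

    supp : Supported t i (t ∸ i) η
    supp r r≤t (inj₁ r<i) = vanish-upwards {η = η} per ηt≡0 i
      (λ r r<i → trans (high r r<i)
        (trans (periodic-s*k+ {η = η} per k (k + r)) (periodic-k+ {η = η} s∣P per r))) r r<i
    supp r r≤t (inj₂ t≤r) =
      trans (cong η (≤-antisym r≤t (subst (_≤ r) (m+[n∸m]≡n i≤t) t≤r))) ηt≡0

  private
    -- Since `k` is -1 modulo `suc t`, `t * k` is 1.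
    t*k+ : Periodic (suc t) η → ∀ z → η (t * k + z) ≡ η (suc z)
    t*k+ per z = periodic-≡ {f = η} per ∣-refl (∣n⇒∣m*n t s∣P) _ _
      (solve 3 (λ t k z → t :* k :+ z :+ (con 1 :+ t) := con 1 :+ z :+ t :* (con 1 :+ k)) refl t k z)
      where open ℕ.+-*-Solver

    -- The shift `k ∸ t` is the difference of `suc k` and `suc t`, hence a multiple of `suc t`.
    Q+ : Periodic (suc t) η → ∀ r → η (k ∸ t + r) ≡ η r
    Q+ per r = periodic-≡ {f = η} per ∣-refl s∣P _ _ (begin
      k ∸ t + r + suc t         ≡⟨ +-suc (k ∸ t + r) t ⟩
      suc (k ∸ t + r + t)       ≡⟨ cong suc (trans (cong (λ y → y + t) (+-comm (k ∸ t) r)) (+-assoc r (k ∸ t) t)) ⟩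
      suc (r + (k ∸ t + t))     ≡⟨ cong (λ y → suc (r + y)) (m∸n+n≡m (suc-∣⇒≤ s∣P)) ⟩
      suc (r + k)               ≡⟨ +-suc r k ⟨
      r + suc k                 ∎)

    k∸i≡ : k ∸ i ≡ k ∸ t + (t ∸ i)
    k∸i≡ = trans (cong (_∸ i) (sym (m∸n+n≡m (suc-∣⇒≤ s∣P)))) (+-∸-assoc (k ∸ t) i≤t)

  -- Now the high equations are instances of the period. A low one equates the residues `r` and
  -- `suc r` with `t ∸ i ≤ r < t`, where `η` is zero.
  supported⇒returns⁻ : Periodic (suc t) η → Supported t 0 (t ∸ i) η → Returns t (k ∸ i) k η
  supported⇒returns⁻ per supp =
    (λ z k∸i≤z z<k →
      let Q≤z = ≤-trans (m≤m+n (k ∸ t) (t ∸ i)) (subst (_≤ z) k∸i≡ k∸i≤z)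
          r , Q+r≡z = m≤n⇒∃[o]m+o≡n Q≤z
          t∸i≤r = +-cancelˡ-≤ (k ∸ t) _ _ (subst₂ _≤_ k∸i≡ (sym Q+r≡z) k∸i≤z)
          r<t = +-cancelˡ-< (k ∸ t) _ _ (subst₂ _<_ (sym Q+r≡z) (sym (m∸n+n≡m (suc-∣⇒≤ s∣P))) z<k)
      in begin
        η z                     ≡⟨ cong η Q+r≡z ⟨
        η (k ∸ t + r)           ≡⟨ Q+ per r ⟩
        η r                     ≡⟨ supp r (<⇒≤ r<t) (inj₂ t∸i≤r) ⟩
        0ℚ                      ≡⟨ supp (suc r) r<t (inj₂ (m≤n⇒m≤1+n t∸i≤r)) ⟨
        η (suc r)               ≡⟨ Q+ per (suc r) ⟨
        η (k ∸ t + suc r)       ≡⟨ cong η (trans (+-suc (k ∸ t) r) (cong suc Q+r≡z)) ⟩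
        η (suc z)               ≡⟨ t*k+ per z ⟨
        η (t * k + z)           ∎) ,
    (λ r _ → trans (sym (periodic-s*k+ {η = η} per k r)) (cong η (s*k+ r)))
    where
    s*k+ : ∀ r → suc t * k + r ≡ t * k + (k + r)
    s*k+ r = trans (cong (λ y → y + r) (+-comm k (t * k))) (+-assoc (t * k) k r)

  -- The halves exchange roles: the first `k ∸ t` high equations give the period, and the low ones
  -- carry the zero at `t` downwards to `t ∸ i`.
  returns⇒supported⁻ : Periodic (suc k) η → η k ≡ 0ℚ → Returns t (k ∸ i) k η →
    Periodic (suc t) η × Supported t 0 (t ∸ i) η
  returns⇒supported⁻ perP ηk≡0 (low , high) = per , supp
    where
    t+Q≡k : t + (k ∸ t) ≡ k
    t+Q≡k = m+[n∸m]≡n (suc-∣⇒≤ s∣P)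

    per : Periodic (suc t) η
    per = returns⇒periodic t (k ∸ t) 0 k η t+Q≡k s∣P perP λ x x<Q →
      trans (high x (≤-trans x<Q (∸-monoʳ-≤ k i≤t)))
        (cong η (trans (sym (+-assoc (t * k) k x)) (cong (λ y → y + x) (+-comm (t * k) k))))

    downwards : ∀ m r → r + m ≡ t → t ∸ i ≤ r → η r ≡ 0ℚ
    downwards zero    r eq _     =
      trans (cong η (trans (sym (+-identityʳ r)) eq)) (trans (sym (periodic-k {η = η} s∣P per)) ηk≡0)
    downwards (suc m) r eq t∸i≤r = begin
      η r                       ≡⟨ Q+ per r ⟨
      η (k ∸ t + r)             ≡⟨ low (k ∸ t + r)
                                     (subst (_≤ k ∸ t + r) (sym k∸i≡) (+-monoʳ-≤ (k ∸ t) t∸i≤r))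
                                     (subst (k ∸ t + r <_) (m∸n+n≡m (suc-∣⇒≤ s∣P)) (+-monoʳ-< (k ∸ t) r<t)) ⟩
      η (t * k + (k ∸ t + r))   ≡⟨ t*k+ per (k ∸ t + r) ⟩
      η (suc (k ∸ t + r))       ≡⟨ cong η (+-suc (k ∸ t) r) ⟨
      η (k ∸ t + suc r)         ≡⟨ Q+ per (suc r) ⟩
      η (suc r)                 ≡⟨ downwards m (suc r) (trans (sym (+-suc r m)) eq) (m≤n⇒m≤1+n t∸i≤r) ⟩
      0ℚ                        ∎
      where
      r<t : r < t
      r<t = subst (r <_) eq (m<m+n r (s≤s z≤n))

    supp : Supported t 0 (t ∸ i) η
    supp r r≤t (inj₂ t∸i≤r) = downwards (t ∸ r) r (m+[n∸m]≡n r≤t) t∸i≤r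

-- Representatives modulo k² + k and the conclusion.

-- If `n` were below `n₀`, then `L` would divide `n₀ ∸ n`, which is positive and less than `L`.
congruent⇒≡ : ∀ {L n₀} n → n₀ ≤ L → 0 < n → + L ℤ.∣ + n - + n₀ → ∃ λ M → n ≡ n₀ + M * L
congruent⇒≡ {L} {n₀} n n₀≤L 0<n L∣ with n₀ ≤? n
... | yes n₀≤n = lift (subst (L ∣_) (cong ℤ.∣_∣ (trans (ℤ.[+m]-[+n]≡m⊖n n n₀) (ℤ.⊖-≥ n₀≤n))) L∣)
  where
  lift : L ∣ n ∸ n₀ → ∃ λ M → n ≡ n₀ + M * L
  lift (divides M eq) = M , trans (sym (m+[n∸m]≡n n₀≤n)) (cong (λ z → n₀ + z) eq)
... | no  n₀≰n = contradiction
  (∣⇒≤ ⦃ >-nonZero (m<n⇒0<n∸m n<n₀) ⦄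
    (subst (L ∣_) (trans (cong ℤ.∣_∣ (ℤ.[+m]-[+n]≡m⊖n n n₀)) (ℤ.∣⊖∣-≤ (<⇒≤ n<n₀))) L∣))
  (<⇒≱ (≤-trans (∸-monoʳ-< 0<n (<⇒≤ n<n₀)) n₀≤L))
  where n<n₀ = ≰⇒> n₀≰n

theorem8p7 : (t k : ℕ) → 2 ≤ t → 2 ≤ k → (t + 1) ∣ (k + 1) →
    (i : ℕ) → i ≤ t →
    (N[ + (t * k + i) , k ]≡ (t ∸ i)) × (N[ + (t * k) - + i , k ]≡ (t ∸ i))
theorem8p7 t k 2≤t 2≤k t+1∣k+1 i i≤t = plus , minus
  where
  instance
    k≢0 : NonZero k
    k≢0 = >-nonZero (≤-trans (s≤s z≤n) 2≤k)

  s∣P : suc t ∣ suc k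
  s∣P = subst₂ _∣_ (+-comm t 1) (+-comm k 1) t+1∣k+1

  t≤k : t ≤ k
  t≤k = suc-∣⇒≤ s∣P

  i≤k : i ≤ k
  i≤k = ≤-trans i≤t t≤k

  i≤tk : i ≤ t * k
  i≤tk = ≤-trans i≤t (m≤m*n t k)

  tk+i≤ : t * k + i ≤ k * k + k
  tk+i≤ = +-mono-≤ (*-monoˡ-≤ k t≤k) i≤k

  -- Here `k + n` is `suc t * k + i` up to the modulus, and the free residues run from `i` to `t` -
  -- 1.
  plus : N[ + (t * k + i) , k ]≡ (t ∸ i)
  plus n k<n L∣ =
    let M , n≡ = congruent⇒≡ n tk+i≤ (≤-trans (s≤s z≤n) k<n) L∣
        k+n≡ = trans (cong (λ z → k + z) n≡) (shape k (t * k) i (M * (k * k + k)))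
    in nullity t i (t ∸ i) n k (≤-reflexive (m+[n∸m]≡n i≤t)) s∣P k<n
      (λ η per supp → returns⇒closes n k (suc t) i M η (periodic-∣ {f = η} per s∣P) i≤k k+n≡
        (supported⇒returns⁺ t i k i≤t s∣P η per supp))
      (λ η per ηk≡0 closes → returns⇒supported⁺ t i k i≤t s∣P η per ηk≡0
        (closes⇒returns n k (suc t) i M η per i≤k k+n≡ closes))
    where
    open ℕ.+-*-Solver
    shape : ∀ k x i y → k + (x + i + y) ≡ k + x + i + y
    shape = solve 4 (λ k x i y → k :+ (x :+ i :+ y) := k :+ x :+ i :+ y) refl

  -- Here `k + n` is `t * k + (k ∸ i)` up to the modulus, and the free residues are those below
  -- `t ∸ i`.
  minus : N[ + (t * k) - + i , k ]≡ (t ∸ i)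
  minus n k<n L∣ =
    let M , n≡ = congruent⇒≡ n (≤-trans (m∸n≤m (t * k) i) (≤-trans (m≤m+n (t * k) i) tk+i≤))
                   (≤-trans (s≤s z≤n) k<n)
                   (subst (λ z → + (k * k + k) ℤ.∣ + n - z)
                     (trans (ℤ.[+m]-[+n]≡m⊖n (t * k) i) (ℤ.⊖-≥ i≤tk)) L∣)
        k+n≡ = trans (cong (λ z → k + z) n≡) (shape (M * (k * k + k)))
    in nullity t 0 (t ∸ i) n k (m∸n≤m t i) s∣P k<n
      (λ η per supp → returns⇒closes n k t (k ∸ i) M η (periodic-∣ {f = η} per s∣P) (m∸n≤m k i) k+n≡
        (supported⇒returns⁻ t i k i≤t s∣P η per supp))
      (λ η per ηk≡0 closes → returns⇒supported⁻ t i k i≤t s∣P η per ηk≡0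
        (closes⇒returns n k t (k ∸ i) M η per (m∸n≤m k i) k+n≡ closes))
    where
    shape : ∀ y → k + (t * k ∸ i + y) ≡ t * k + (k ∸ i) + y
    shape y = begin
      k + (t * k ∸ i + y)     ≡⟨ sym (+-assoc k (t * k ∸ i) y) ⟩
      k + (t * k ∸ i) + y     ≡⟨ cong (λ z → z + y) (sym (+-∸-assoc k i≤tk)) ⟩
      k + t * k ∸ i + y       ≡⟨ cong (λ z → z ∸ i + y) (+-comm k (t * k)) ⟩
      t * k + k ∸ i + y       ≡⟨ cong (λ z → z + y) (+-∸-assoc (t * k) i≤k) ⟩
      t * k + (k ∸ i) + y     ∎
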